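{- The class of circle graphs is not induced-tw-bounded.
   Context: A chord of a circle is a closed line segment with distinct endpoints on the circle; two chords cross if they intersect at a point other than an endpoint of either. A circle graph is a graph isomorphic to the graph whose vertices are the chords of a finite set of chords of a circle (no three crossing at one point), two chords adjacent iff they cross. A hereditary class $\mathcal{G}$ (closed under isomorphism and induced subgraphs) is induced-tw-bounded if there is a function $f$ such that every $G\in\mathcal{G}$ with $\operatorname{tw}(G)\ge f(t)$ contains, as an induced subgraph, one of: $K_t$; $K_{t,t}$; a subdivision of the $(t\times t)$-wall; or the line graph of a subdivision of the $(t\times t)$-wall. Here the $(t\times t)$-wall is the standard elementary wall: start from the grid with vertices $(i,j)$, $1\le i\le t$, $1\le j\le 2t$, with $(i,j)$ adjacent to $(i,j+1)$ and $(i+1,j)$; delete the vertical edges $(i,j)(i+1,j)$ with $i+j$ odd; then delete vertices of degree one. -}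

module Defs where

open import Data.Nat using (ℕ; zero; suc; _+_; _*_; _<_; _≤_; _≡ᵇ_; _%_)
open import Data.Bool using (Bool; true; false; _∧_; _∨_; not; if_then_else_)
open import Data.Fin using (Fin; zero; suc; toℕ; inject₁; fromℕ)
open import Data.Fin.Subset using (Subset; _∈_; ∣_∣)
open import Data.List using (List; map; allFin)
open import Data.Nat.ListAction using (sum)
open import Data.Product using (Σ; _×_; _,_; proj₁; proj₂)
open import Data.Sum using (_⊎_; inj₁; inj₂)
open import Data.Unit using (⊤)
open import Relation.Nullary using (¬_)
open import Relation.Binary.PropositionalEquality using (_≡_; _≢_)
open import Function.Definitions using (Injective)
open import Function using (_∘_)

record FinGraph : Set where
  field
    n      : ℕ
    adj    : Fin n → Fin n → Bool
    sym    : ∀ u v → adj u v ≡ adj v u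
    irrefl : ∀ u → adj u u ≡ false
open FinGraph public

data PathIn (G : FinGraph) (P : Fin (n G) → Set) : Fin (n G) → Fin (n G) → Set where
  here : ∀ {x} → P x → PathIn G P x x
  step : ∀ {x y z} → P x → adj G x y ≡ true → PathIn G P y z → PathIn G P x z

Connected : FinGraph → Set
Connected G = ∀ x y → PathIn G (λ _ → ⊤) x y

HasCycle : FinGraph → Set
HasCycle G =
  Σ ℕ λ k → Σ (Fin (suc (suc (suc k))) → Fin (n G)) λ c →
    Injective _≡_ _≡_ c
    × (∀ (i : Fin (suc (suc k))) → adj G (c (inject₁ i)) (c (suc i)) ≡ true)
    × adj G (c (fromℕ (suc (suc k)))) (c zero) ≡ true

IsTree : FinGraph → Set
IsTree T = (1 ≤ n T) × Connected T × ¬ HasCycle T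

HasTreeDecomp : FinGraph → ℕ → Set
HasTreeDecomp G w =
  Σ FinGraph λ T → IsTree T × Σ (Fin (n T) → Subset (n G)) λ bag →
      (∀ v → Σ (Fin (n T)) λ x → v ∈ bag x)
    × (∀ u v → adj G u v ≡ true → Σ (Fin (n T)) λ x → (u ∈ bag x) × (v ∈ bag x))
    × (∀ v x y → v ∈ bag x → v ∈ bag y → PathIn T (λ z → v ∈ bag z) x y)
    × (∀ x → ∣ bag x ∣ ≤ suc w)

TwAtLeast : FinGraph → ℕ → Set
TwAtLeast G k = ∀ w → HasTreeDecomp G w → k ≤ w

record PGraph : Set₁ where
  field
    V : Set
    E : V → V → Set

InducedIn : PGraph → FinGraph → Set
InducedIn H G =
  Σ (PGraph.V H → Fin (n G)) λ φ →
    Injective _≡_ _≡_ φ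
    × (∀ u v → (adj G (φ u) (φ v) ≡ true → PGraph.E H u v)
              × (PGraph.E H u v → adj G (φ u) (φ v) ≡ true))

K : ℕ → PGraph
K t = record { V = Fin t ; E = λ u v → u ≢ v }

Kbip : ℕ → PGraph
Kbip t = record { V = Fin t ⊎ Fin t ; E = e }
  where
  e : Fin t ⊎ Fin t → Fin t ⊎ Fin t → Set
  e (inj₁ _) (inj₂ _) = ⊤
  e (inj₂ _) (inj₁ _) = ⊤
  e _ _ = Data.Empty.⊥
    where import Data.Empty

-- The (t × t)-wall (0-based coordinates: row i < t, column j < 2t)

even : ℕ → Bool
even m = m % 2 ≡ᵇ 0

-- grid with vertical edges (i,j)(i+1,j) only when i+j is even
-- (same parity condition as with 1-based coordinates)
gridAdj : (t : ℕ) → Fin t × Fin (2 * t) → Fin t × Fin (2 * t) → Bool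
gridAdj t (i , j) (i' , j') =
  ((toℕ i ≡ᵇ toℕ i') ∧ ((suc (toℕ j) ≡ᵇ toℕ j') ∨ (suc (toℕ j') ≡ᵇ toℕ j)))
  ∨ ((toℕ j ≡ᵇ toℕ j') ∧
       (((suc (toℕ i) ≡ᵇ toℕ i') ∧ even (toℕ i + toℕ j))
      ∨ ((suc (toℕ i') ≡ᵇ toℕ i) ∧ even (toℕ i' + toℕ j))))

gridDeg : (t : ℕ) → Fin t × Fin (2 * t) → ℕ
gridDeg t v =
  sum (map (λ i → sum (map (λ j → if gridAdj t v (i , j) then 1 else 0)
                           (allFin (2 * t))))
           (allFin t))

wallKept : (t : ℕ) → Fin t × Fin (2 * t) → Bool
wallKept t v = not (gridDeg t v ≡ᵇ 1)

Wall : ℕ → PGraph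
Wall t = record
  { V = Σ (Fin t × Fin (2 * t)) (λ v → wallKept t v ≡ true)
  ; E = λ u v → gridAdj t (proj₁ u) (proj₁ v) ≡ true }

-- a strict order on wall vertices (lexicographic), used to orient edges
wallKey : (t : ℕ) → PGraph.V (Wall t) → ℕ
wallKey t ((i , j) , _) = toℕ i * (2 * t) + toℕ j

-- edges of H, each listed once (oriented by an injective key)
Edge : (H : PGraph) → (PGraph.V H → ℕ) → Set
Edge H key = Σ (PGraph.V H × PGraph.V H) λ p →
  PGraph.E H (proj₁ p) (proj₂ p) × (key (proj₁ p) < key (proj₂ p))

pathPt : ∀ {A : Set} → A → A → (ℓ : ℕ) → (Fin ℓ → A) → Fin (suc (suc ℓ)) → A
pathPt a b ℓ mid zero = a
pathPt a b zero mid (suc zero) = b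
pathPt a b zero mid (suc (suc ()))
pathPt a b (suc ℓ) mid (suc zero) = mid zero
pathPt a b (suc ℓ) mid (suc (suc k)) = pathPt (mid zero) b ℓ (mid ∘ suc) (suc k)

module Subdivision (H : PGraph) (key : PGraph.V H → ℕ) (ℓ : Edge H key → ℕ) where
  SV : Set
  SV = PGraph.V H ⊎ Σ (Edge H key) (λ e → Fin (ℓ e))

  pt : (e : Edge H key) → Fin (suc (suc (ℓ e))) → SV
  pt e = pathPt (inj₁ (proj₁ (proj₁ e))) (inj₁ (proj₂ (proj₁ e))) (ℓ e) (λ i → inj₂ (e , i))

  SEdge : Set
  SEdge = Σ (Edge H key) (λ e → Fin (suc (ℓ e)))

  ends : SEdge → Fin 2 → SV
  ends (e , k) zero = pt e (inject₁ k)
  ends (e , k) (suc _) = pt e (suc k)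

  SE : SV → SV → Set
  SE x y = Σ SEdge λ f → (ends f zero ≡ x × ends f (suc zero) ≡ y)
                        ⊎ (ends f zero ≡ y × ends f (suc zero) ≡ x)

  subdivision : PGraph
  subdivision = record { V = SV ; E = SE }

  lineGraph : PGraph
  lineGraph = record
    { V = SEdge
    ; E = λ f g → (f ≢ g) × Σ (Fin 2) λ a → Σ (Fin 2) λ b → ends f a ≡ ends g b }

SubdivWall : (t : ℕ) → (Edge (Wall t) (wallKey t) → ℕ) → PGraph
SubdivWall t ℓ = Subdivision.subdivision (Wall t) (wallKey t) ℓ

LineSubdivWall : (t : ℕ) → (Edge (Wall t) (wallKey t) → ℕ) → PGraph
LineSubdivWall t ℓ = Subdivision.lineGraph (Wall t) (wallKey t) ℓ

Obstruction : ℕ → FinGraph → Set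
Obstruction t G =
    InducedIn (K t) G
  ⊎ InducedIn (Kbip t) G
  ⊎ (Σ (Edge (Wall t) (wallKey t) → ℕ) λ ℓ → InducedIn (SubdivWall t ℓ) G)
  ⊎ (Σ (Edge (Wall t) (wallKey t) → ℕ) λ ℓ → InducedIn (LineSubdivWall t ℓ) G)

InducedTwBounded : (FinGraph → Set) → Set
InducedTwBounded 𝒢 =
  Σ (ℕ → ℕ) λ f → ∀ (G : FinGraph) → 𝒢 G → ∀ (t : ℕ) → TwAtLeast G (f t) → Obstruction t G

-- Circle graphs. A chord is given by its two endpoints, recorded by their
-- positions in the cyclic order around the circle (natural numbers a < b).

Chord : Set
Chord = ℕ × ℕ

Crosses : Chord → Chord → Set
Crosses (a , b) (c , d) = (a < c × c < b × b < d) ⊎ (c < a × a < d × d < b)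

IsCircleGraph : FinGraph → Set
IsCircleGraph G =
  Σ (Fin (n G) → Chord) λ ch →
    (∀ v → proj₁ (ch v) < proj₂ (ch v))
    × Injective _≡_ _≡_ ch
    × (∀ u v → (adj G u v ≡ true → Crosses (ch u) (ch v))
              × (Crosses (ch u) (ch v) → adj G u v ≡ true))

{-# OPTIONS --safe #-}
-- Refine a system of chords repeatedly: spread out its endpoints and surround every position on
-- the circle by a short new chord, consecutive new chords crossing. Each generation of new chords
-- induces a path that touches every older generation, so k generations form a K_k minor and the
-- treewidth is at least k - 1. A new chord crosses at most one older chord and two neighbours on
-- its path; this makes the graph triangle-free and 2-degenerate, which excludes K_3, K_3,3 and
-- line graphs of subdivided walls. Subdivided walls are not circle graphs at all: if c crosses
-- pairwise disjoint chords x, y, z, then one of these separates the other two, whereas the bricks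
-- around a vertex of the wall connect any two of its neighbours away from the third.
module Submission where

open import Defs renaming (sym to adj-sym)
open import Data.Bool using (true)
open import Data.Bool.Properties using () renaming (_≟_ to _≟ᵇ_)
open import Data.Empty using (⊥)
open import Data.Fin using (Fin; zero; suc; toℕ; inject₁; fromℕ; fromℕ<; #_; _≟_)
open import Data.Fin.Properties using (any?; all?; ¬∀⟶∃¬; suc-injective; toℕ-injective; toℕ<n; toℕ-fromℕ<; +↔⊎; 0↔⊥)
open import Data.Fin.Subset using (Subset; ⊤; _∈_; _∉_; ∣_∣; _-_)
open import Data.Fin.Subset.Properties using (_∈?_; ∈⊤; p─q⊆p; x∈p∧x≢y⇒x∈p-y; x∈p⇒∣p-x∣<∣p∣)
open import Data.Nat using (ℕ; zero; suc; _+_; _*_; _%_; _≤_; _<_; _≤?_; _<?_; z≤n; z<s; s≤s; s≤s⁻¹)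
open import Data.Nat.DivMod using ([m+kn]%n≡m%n)
open import Data.Nat.Properties using (*-cancelʳ-<; *-cancelʳ-≡; *-monoˡ-<; *-monoˡ-≤; +-cancelˡ-<; +-cancelˡ-≡; +-monoʳ-<; +-monoʳ-≤; +-monoˡ-<; 1+n≢n; <-asym; <-cmp; <-irrefl; <-trans; <-≤-trans; <⇒≤; m<n+m; m≤m+n; m≤n+m; n<1+n; ≤-<-trans; ≤-antisym; ≤-refl; ≤-reflexive; ≤-total; ≤-trans; ≮⇒≥) renaming (suc-injective to ℕ-suc-injective)
open import Data.Product using (∃; _×_; _,_; proj₁; proj₂)
open import Data.Product.Properties using (≡-dec)
open import Data.Sum using (_⊎_; inj₁; inj₂)
open import Data.Sum.Function.Propositional using (_⊎-↔_)
open import Data.Sum.Properties using (inj₁-injective; inj₂-injective)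
open import Data.Unit using (tt)
open import Data.Vec using (_∷_; there)
open import Function using (_∘_; id; _↔_; Inverse; mk⇔)
open import Function.Construct.Identity using (↔-id)
open import Function.Definitions using (Injective)
open import Function.Properties.Inverse using (↔-trans)
open import Relation.Binary.Construct.Closure.ReflexiveTransitive using (Star; ε; _◅_; _◅◅_; gmap)
open import Relation.Binary.Definitions using (tri<; tri≈; tri>)
open import Relation.Binary.PropositionalEquality using (_≡_; _≢_; refl; sym; trans; cong; cong₂; subst; subst₂)
open import Relation.Nullary using (¬_; Dec; yes; no; does; contradiction)
open import Relation.Nullary.Decidable using (True; False; toWitness; toWitnessFalse; _×-dec_; _⊎-dec_; dec-true; dec-false; does-⇔)

-- Tree decompositions and complete minors

x∉p-x : ∀ {N} (p : Subset N) x → x ∉ p - x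
x∉p-x (_ ∷ p) (suc x) (there x∈) = x∉p-x p x x∈

module _ {G : FinGraph} where

  path-source : ∀ {P x y} → PathIn G P x y → P x
  path-source (here p)     = p
  path-source (step p _ _) = p

  path-map : ∀ {P Q : Fin (n G) → Set} {x y} →
             (∀ {z} → P z → Q z) → PathIn G P x y → PathIn G Q x y
  path-map f (here p)     = here (f p)
  path-map f (step p e π) = step (f p) e (path-map f π)

  path-trans : ∀ {P x y z} → PathIn G P x y → PathIn G P y z → PathIn G P x z
  path-trans (here _)     ρ = ρ
  path-trans (step p e π) ρ = step p e (path-trans π ρ)

  path-sym : ∀ {P x y} → PathIn G P x y → PathIn G P y x
  path-sym (here p) = here p
  path-sym (step {x} {y} p e π) =
    path-trans (path-sym π) (step (path-source π) (trans (adj-sym G y x) e) (here p))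

  -- Cuts the path after its last visit to `x`; what follows starts at a neighbour of `x`.
  path-leave : ∀ {P : Fin (n G) → Set} {a s} x → s ≢ x → PathIn G P a s →
    PathIn G (λ w → P w × w ≢ x) a s
    ⊎ ∃ λ y → adj G x y ≡ true × PathIn G (λ w → P w × w ≢ x) y s
  path-leave x s≢x (here p) = inj₁ (here (p , s≢x))
  path-leave x s≢x (step {a} {b} p e π) with path-leave x s≢x π
  ... | inj₂ r = inj₂ r
  ... | inj₁ ρ with a ≟ x
  ...   | yes refl = inj₂ (b , e , ρ)
  ...   | no  a≢x  = inj₁ (step (p , a≢x) e ρ)

  path-depart : ∀ {P : Fin (n G) → Set} {x s} → s ≢ x → PathIn G P x s →
    ∃ λ y → adj G x y ≡ true × PathIn G (λ w → P w × w ≢ x) y s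
  path-depart {x = x} s≢x π with path-leave x s≢x π
  ... | inj₁ ρ = contradiction refl (proj₂ (path-source ρ))
  ... | inj₂ r = r

  record IsSimple (P : Fin (n G) → Set) (k : ℕ) (c : Fin (suc k) → Fin (n G)) : Set where
    constructor mkSimple
    field
      injective  : Injective _≡_ _≡_ c
      linked     : ∀ (i : Fin k) → adj G (c (inject₁ i)) (c (suc i)) ≡ true
      everywhere : ∀ i → P (c i)

  prepend : ∀ {k} → Fin (n G) → (Fin k → Fin (n G)) → Fin (suc k) → Fin (n G)
  prepend x c zero    = x
  prepend x c (suc i) = c i

  prepend-injective : ∀ {k x} {c : Fin k → Fin (n G)} →
    Injective _≡_ _≡_ c → (∀ i → c i ≢ x) → Injective _≡_ _≡_ (prepend x c)
  prepend-injective inj x∉c {zero}  {zero}  _  = refl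
  prepend-injective inj x∉c {zero}  {suc j} eq = contradiction (sym eq) (x∉c j)
  prepend-injective inj x∉c {suc i} {zero}  eq = contradiction eq (x∉c i)
  prepend-injective inj x∉c {suc i} {suc j} eq = cong suc (inj eq)

  prepend-linked : ∀ {k x} {c : Fin (suc k) → Fin (n G)} → adj G x (c zero) ≡ true →
    (∀ (i : Fin k) → adj G (c (inject₁ i)) (c (suc i)) ≡ true) →
    ∀ (i : Fin (suc k)) → adj G (prepend x c (inject₁ i)) (prepend x c (suc i)) ≡ true
  prepend-linked e l zero    = e
  prepend-linked e l (suc i) = l i

  SimplePath : (Fin (n G) → Set) → Fin (n G) → Fin (n G) → Set
  SimplePath P x y = ∃ λ k → ∃ λ c → c zero ≡ x × c (fromℕ k) ≡ y × IsSimple P k c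

  suffix : ∀ {P} k c → IsSimple P k c → ∀ i → SimplePath P (c i) (c (fromℕ k))
  suffix k       c S zero    = k , c , refl , refl , S
  suffix (suc k) c (mkSimple inj l p) (suc i) =
    suffix k (c ∘ suc) (mkSimple (suc-injective ∘ inj) (l ∘ suc) (p ∘ suc)) i

  -- Loop erasure: if the head already occurs on the simplified tail, the path restarts from that
  -- occurrence.
  simplify : ∀ {P x y} → PathIn G P x y → SimplePath P x y
  simplify (here {x} p) =
    0 , (λ _ → x) , refl , refl , mkSimple (λ { {zero} {zero} _ → refl }) (λ ()) (λ _ → p)
  simplify (step {x} p e π) with simplify π
  ... | k , c , refl , refl , S with any? (λ i → c i ≟ x)
  ...   | yes (i , refl) = suffix k c S i
  ...   | no  x∉c = suc k , prepend x c , refl , refl ,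
      mkSimple (prepend-injective injective λ i eq → x∉c (i , eq)) (prepend-linked e linked)
               λ { zero → p ; (suc i) → everywhere i }
    where open IsSimple S

  -- As `y` and `z` differ, the simplified path has at least two vertices; `x` lies off it and
  -- closes it to a cycle.
  detour⇒cycle : ∀ {x y z} → adj G x y ≡ true → adj G x z ≡ true → y ≢ z →
                 PathIn G (_≢ x) y z → HasCycle G
  detour⇒cycle {x} {y} {z} xy xz y≢z π with simplify π
  ... | zero  , c , refl , refl , _ = contradiction refl y≢z
  ... | suc k , c , refl , refl , S =
      k , prepend x c , prepend-injective injective everywhere , prepend-linked xy linked ,
      trans (adj-sym G z x) xz
    where open IsSimple S

-- Helly property of subtrees: as long as the current node misses some S i, move one step
-- towards S i. The walk never turns back, as two consecutive steps across the same edge would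
-- separate two of the sets; so in a tree it visits new nodes only, and it has to stop.
module Helly
  (T : FinGraph) (tree : IsTree T) {m : ℕ} (S : Fin m → Fin (n T) → Set)
  (S? : ∀ x i → Dec (S i x))
  (connected : ∀ i {x y} → S i x → S i y → PathIn T (S i) x y)
  (meet : ∀ i j → ∃ λ z → S i z × S j z)
  where

  private
    V = Fin (n T)
    acyclic : ¬ HasCycle T
    acyclic = proj₂ (proj₂ tree)

  -- The reason for a step from `p` to `x`; that the target set is reached off `p` is what later
  -- forbids the step back.
  Towards : V → V → Set
  Towards p x = ∃ λ i → ¬ S i p × ∃ λ s → S i s × PathIn T (_≢ p) x s

  next : ∀ x → (∀ i → S i x) ⊎ ∃ λ y → adj T x y ≡ true × Towards x y
  next x with all? (S? x)
  ... | yes all = inj₁ all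
  ... | no ¬all with ¬∀⟶∃¬ m _ (S? x) ¬all
  -- The diagonal case of `meet` provides an element of `S i`.
  ...   | i , ¬Sx with meet i i
  ...     | s , Ss , _ with path-depart (λ { refl → ¬Sx Ss }) (proj₁ (proj₂ tree) x s)
  ...       | y , xy , π = inj₂ (y , xy , i , ¬Sx , s , Ss , path-map proj₂ π)

  extend : ∀ {p x i s z} → ¬ S i p → S i s → S i z → PathIn T (_≢ p) x s → PathIn T (_≢ p) x z
  extend ¬Sp Ss Sz π = path-trans π (path-map (λ { Sw refl → ¬Sp Sw }) (connected _ Ss Sz))

  -- A common node of the two target sets is reached from `x` off `p` and from `p` off `x`. Joined
  -- together, the two paths lead from `p` to a second neighbour of `x` and close a cycle.
  no-return : ∀ {p x} → adj T x p ≡ true → Towards p x → ¬ Towards x p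
  no-return {p} {x} xp (i , ¬Sp , s , Ss , π) (j , ¬Sx , r , Sr , ρ) with meet i j
  ... | z , Sz , Sz′ with path-depart (λ { refl → ¬Sx Sz′ }) (extend ¬Sp Ss Sz π)
  ...   | y , xy , σ = acyclic (detour⇒cycle xp xy (λ { refl → proj₁ (path-source σ) refl })
            (path-trans (extend ¬Sx Sr Sz′ ρ) (path-sym (path-map proj₂ σ))))

  -- `U` holds the unvisited nodes, and by `reach` every visited node other than `x` is joined to
  -- `p` off `x`. A step to a visited node would therefore close a cycle through `x`, and a step to
  -- a new node shrinks `U`.
  search : ∀ fuel (U : Subset (n T)) {p x} → ∣ U ∣ < fuel → adj T x p ≡ true → Towards p x →
           (∀ {v} → v ∉ U → v ≢ x → PathIn T (λ w → w ∉ U × w ≢ x) p v) → x ∉ U →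
           ∃ λ y → ∀ i → S i y
  search (suc fuel) U {p} {x} U<fuel xp px reach x∉U with next x
  ... | inj₁ all = x , all
  ... | inj₂ (y , xy , yx) with y ∈? U
  ...   | no y∉U = contradiction (detour⇒cycle xp xy p≢y (path-map proj₂ (reach y∉U y≢x))) acyclic
    where
    p≢y : p ≢ y
    p≢y refl = no-return xp px yx
    y≢x : y ≢ x
    y≢x refl with () ← trans (sym xy) (irrefl T x)
  ...   | yes y∈U =
      search fuel (U - y) (<-≤-trans (x∈p⇒∣p-x∣<∣p∣ y∈U) (s≤s⁻¹ U<fuel))
             (trans (adj-sym T y x) xy) yx reach′ (x∉p-x U y)
    where
    stay : ∀ {w} → w ∉ U → w ∉ U - y
    stay w∉U w∈ = w∉U (p─q⊆p _ _ w∈)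
    old : ∀ {w} → w ∉ U → w ∉ U - y × w ≢ y
    old w∉U = stay w∉U , λ { refl → w∉U y∈U }
    reach′ : ∀ {v} → v ∉ U - y → v ≢ y → PathIn T (λ w → w ∉ U - y × w ≢ y) x v
    reach′ {v} v∉ v≢y with v ≟ x
    ... | yes refl = here (old x∉U)
    ... | no  v≢x  = step (old x∉U) xp (path-map (old ∘ proj₁)
                       (reach (λ v∈U → v∉ (x∈p∧x≢y⇒x∈p-y v∈U v≢y)) v≢x))

  common-node : ∃ λ y → ∀ i → S i y
  common-node with next (fromℕ< (proj₁ tree))
  ... | inj₁ all = _ , all
  ... | inj₂ (x , rx , xr) = search _ (⊤ - r - x) ≤-refl
        (trans (adj-sym T x r) rx) xr reach (x∉p-x _ x)
    where
    r : V
    r = fromℕ< (proj₁ tree)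
    r≢x : r ≢ x
    r≢x refl with () ← trans (sym rx) (irrefl T r)
    r∉U : r ∉ ⊤ - r - x
    r∉U r∈ = x∉p-x _ r (p─q⊆p _ _ r∈)
    reach : ∀ {v} → v ∉ ⊤ - r - x → v ≢ x →
            PathIn T (λ w → w ∉ ⊤ - r - x × w ≢ x) r v
    reach {v} v∉ v≢x with v ≟ r
    ... | yes refl = here (r∉U , r≢x)
    ... | no  v≢r  = contradiction (x∈p∧x≢y⇒x∈p-y (x∈p∧x≢y⇒x∈p-y ∈⊤ v≢r) v≢x) v∉

injection⇒≤∣p∣ : ∀ {N} m (p : Subset N) (f : Fin m → Fin N) →
                 Injective _≡_ _≡_ f → (∀ i → f i ∈ p) → m ≤ ∣ p ∣
injection⇒≤∣p∣ zero    p f inj f∈p = z≤n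
injection⇒≤∣p∣ (suc m) p f inj f∈p =
  ≤-trans (s≤s (injection⇒≤∣p∣ m (p - f zero) (f ∘ suc) (suc-injective ∘ inj)
             λ i → x∈p∧x≢y⇒x∈p-y (f∈p (suc i)) ((λ ()) ∘ inj {suc i} {zero})))
          (x∈p⇒∣p-x∣<∣p∣ (f∈p zero))

-- The fibres of `level` are the branch sets of a complete minor on m vertices.
complete-minor⇒m≤1+w : ∀ (G : FinGraph) {m} (level : Fin (n G) → Fin m) →
  (∀ u v → level u ≡ level v →
     Star (λ u v → level u ≡ level v × adj G u v ≡ true) u v) →
  (∀ i j → i ≢ j → ∃ λ u → ∃ λ v → level u ≡ i × level v ≡ j × adj G u v ≡ true) →
  (∀ i → ∃ λ u → level u ≡ i) →
  ∀ {w} → HasTreeDecomp G w → m ≤ suc w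
complete-minor⇒m≤1+w G {m} level connected touch inhabited {w}
    (T , tree , bag , cover , edge , subtree , small) =
  -- The bag of the common node holds a vertex of every level, and vertices of different levels are
  -- distinct.
  ≤-trans (injection⇒≤∣p∣ m (bag x) (proj₁ ∘ all)
             (λ {i} {j} eq → trans (sym (proj₁ (proj₂ (all i))))
                               (trans (cong level eq) (proj₁ (proj₂ (all j)))))
             (proj₂ ∘ proj₂ ∘ all))
          (small x)
  where
  S : Fin m → Fin (n T) → Set
  S i x = ∃ λ v → level v ≡ i × v ∈ bag x

  -- Consecutive vertices of the walk share a bag, where their subtrees are joined; the level stays
  -- constant along the walk.
  trace : ∀ {u v} → Star (λ u v → level u ≡ level v × adj G u v ≡ true) u v →
          ∀ {x y} → u ∈ bag x → v ∈ bag y → PathIn T (S (level u)) x y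
  trace {u} ε {x} {y} u∈ v∈ = path-map (λ w∈ → u , refl , w∈) (subtree u x y u∈ v∈)
  trace {u} (_◅_ {j = u′} (same , uu′) π) {x} u∈ v∈ with edge u u′ uu′
  ... | z , u∈z , u′∈z = path-trans
    (path-map (λ w∈ → u , refl , w∈) (subtree u x z u∈ u∈z))
    (subst (λ i → PathIn T (S i) _ _) (sym same) (trace π u′∈z v∈))

  meet : ∀ i j → ∃ λ z → S i z × S j z
  meet i j with i ≟ j
  ... | yes refl = let u , lu = inhabited i ; z , u∈ = cover u
                   in z , (u , lu , u∈) , (u , lu , u∈)
  ... | no i≢j   = let u , v , lu , lv , uv = touch i j i≢j ; z , u∈ , v∈ = edge u v uv
                   in z , (u , lu , u∈) , (v , lv , v∈)

  common : ∃ λ x → ∀ i → S i x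
  common = Helly.common-node T tree S
    (λ x i → any? λ v → (level v ≟ i) ×-dec (v ∈? bag x))
    (λ { i (u , refl , u∈) (v , lv , v∈) → trace (connected u v (sym lv)) u∈ v∈ })
    meet

  x = proj₁ common
  all = proj₂ common

-- Chords

crosses? : ∀ x y → Dec (Crosses x y)
crosses? (a , b) (c , d) =
  (a <? c ×-dec c <? b ×-dec b <? d) ⊎-dec (c <? a ×-dec a <? d ×-dec d <? b)

crosses-irrefl : ∀ {x} → ¬ Crosses x x
crosses-irrefl (inj₁ (a<a , _)) = <-irrefl refl a<a
crosses-irrefl (inj₂ (a<a , _)) = <-irrefl refl a<a

crosses-sym : ∀ {x y} → Crosses x y → Crosses y x
crosses-sym (inj₁ p) = inj₂ p
crosses-sym (inj₂ p) = inj₁ p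

Inside : Chord → Chord → Set
Inside (a , b) (c , d) = a ≤ c × d ≤ b

inside? : ∀ x y → Dec (Inside x y)
inside? (a , b) (c , d) = (a ≤? c) ×-dec (d ≤? b)

inside-antisym : ∀ {x y} → Inside x y → Inside y x → x ≡ y
inside-antisym (a≤c , d≤b) (c≤a , b≤d) = cong₂ _,_ (≤-antisym a≤c c≤a) (≤-antisym b≤d d≤b)

-- A chord that crosses `u` has an end strictly between the ends of `u`, hence strictly between
-- those of `x`; its other end cannot escape without crossing `x`.
inside-crosses : ∀ {x u v} → ¬ Crosses x v → Crosses u v → Inside x u → Inside x v
inside-crosses {a , b} {c , d} {e , f} x∥v (inj₁ (c<e , e<d , d<f)) (a≤c , d≤b) =
  <⇒≤ a<e , ≮⇒≥ λ b<f → x∥v (inj₁ (a<e , <-≤-trans e<d d≤b , b<f))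
  where
  a<e : a < e
  a<e = ≤-<-trans a≤c c<e
inside-crosses {a , b} {c , d} {e , f} x∥v (inj₂ (e<c , c<f , f<d)) (a≤c , d≤b) =
  ≮⇒≥ (λ e<a → x∥v (inj₂ (e<a , ≤-<-trans a≤c c<f , f<b))) , <⇒≤ f<b
  where
  f<b : f < b
  f<b = <-≤-trans f<d d≤b

infix 4 _∋_
_∋_ : Chord → ℕ → Set
(a , b) ∋ p = a < p × p < b

Apart : Chord → Chord → Set
Apart x y = ∀ {p} → x ∋ p → ¬ y ∋ p

crosses⇒∋ : ∀ {c x} → Crosses c x → x ∋ proj₁ c ⊎ x ∋ proj₂ c
crosses⇒∋ (inj₁ (c₁<x₁ , x₁<c₂ , c₂<x₂)) = inj₂ (x₁<c₂ , c₂<x₂)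
crosses⇒∋ (inj₂ (x₁<c₁ , c₁<x₂ , x₂<c₂)) = inj₁ (x₁<c₁ , c₁<x₂)

crosses⇒¬both : ∀ {c x} → Crosses c x → x ∋ proj₁ c → ¬ x ∋ proj₂ c
crosses⇒¬both (inj₁ (c₁<x₁ , _)) (x₁<c₁ , _) _ = <-asym c₁<x₁ x₁<c₁
crosses⇒¬both (inj₂ (_ , _ , x₂<c₂)) _ (_ , c₂<x₂) = <-asym x₂<c₂ c₂<x₂

inside-∋ : ∀ {x y p} → Inside x y → y ∋ p → x ∋ p
inside-∋ (a≤c , d≤b) (c<p , p<d) = ≤-<-trans a≤c c<p , <-≤-trans p<d d≤b

-- Arcs with a common point are nested or overlap partially, and a partial overlap is a crossing.
unnested⇒apart : ∀ {x y} → ¬ Crosses x y → ¬ Inside x y → ¬ Inside y x → Apart x y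
unnested⇒apart {a , b} {c , d} x∥y x⊉y y⊉x (a<p , p<b) (c<p , p<d) with <-cmp a c | <-cmp b d
... | tri< a<c _ _ | tri< b<d _ _ = x∥y (inj₁ (a<c , <-trans c<p p<b , b<d))
... | tri< a<c _ _ | tri≈ _ b≡d _ = x⊉y (<⇒≤ a<c , ≤-reflexive (sym b≡d))
... | tri< a<c _ _ | tri> _ _ d<b = x⊉y (<⇒≤ a<c , <⇒≤ d<b)
... | tri≈ _ a≡c _ | tri< b<d _ _ = y⊉x (≤-reflexive (sym a≡c) , <⇒≤ b<d)
... | tri≈ _ a≡c _ | tri≈ _ b≡d _ = x⊉y (≤-reflexive a≡c , ≤-reflexive (sym b≡d))
... | tri≈ _ a≡c _ | tri> _ _ d<b = x⊉y (≤-reflexive a≡c , <⇒≤ d<b)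
... | tri> _ _ c<a | tri< b<d _ _ = y⊉x (<⇒≤ c<a , <⇒≤ b<d)
... | tri> _ _ c<a | tri≈ _ b≡d _ = y⊉x (<⇒≤ c<a , ≤-reflexive b≡d)
... | tri> _ _ c<a | tri> _ _ d<b = x∥y (inj₂ (c<a , <-trans a<p p<d , d<b))

-- For `y` and `z` that do not cross `x`, this expresses that `x` does not separate them.
SameSide : Chord → Chord → Chord → Set
SameSide x y z = (Inside x y → Inside x z) × (Inside x z → Inside x y)

sameSide-sym : ∀ {x y z} → SameSide x y z → SameSide x z y
sameSide-sym (f , g) = g , f

sameSide-trans : ∀ {x y z w} → SameSide x y z → SameSide x z w → SameSide x y w
sameSide-trans (f , g) (h , k) = h ∘ f , g ∘ k

crosses⇒sameSide : ∀ {x u v} → ¬ Crosses x u → ¬ Crosses x v → Crosses u v → SameSide x u v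
crosses⇒sameSide x∥u x∥v uv = inside-crosses x∥v uv , inside-crosses x∥u (crosses-sym uv)

-- If none of x, y, z separates the other two, then the arcs they cut off are disjoint, and c
-- would need an end in each of the three.
module _ {c : Chord} where

  private
    -- The ends of `c` in the disjoint arcs of `y` and `z` are different ends, so both would lie in
    -- the arc of `x`.
    nested : ∀ {x y z} → Crosses c x → Crosses c y → Crosses c z →
             Apart y z → Inside x y → ¬ Inside x z
    nested cx cy cz y#z x⊇y x⊇z with crosses⇒∋ cy | crosses⇒∋ cz
    ... | inj₁ p | inj₁ q = y#z p q
    ... | inj₂ p | inj₂ q = y#z p q
    ... | inj₁ p | inj₂ q = crosses⇒¬both cx (inside-∋ x⊇y p) (inside-∋ x⊇z q)
    ... | inj₂ p | inj₁ q = crosses⇒¬both cx (inside-∋ x⊇z q) (inside-∋ x⊇y p)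

    -- `x` contains `z` as well. If one of `y` and `z` contained the other, it would also contain
    -- `x` and so equal it; hence they are apart and `nested` applies.
    outer : ∀ {x y z} → Crosses c x → Crosses c y → Crosses c z →
            ¬ Crosses y z → x ≢ y → x ≢ z →
            SameSide x y z → SameSide y x z → SameSide z x y → ¬ Inside x y
    outer cx cy cz y∥z x≢y x≢z X Y Z x⊇y =
      nested cx cy cz
        (unnested⇒apart y∥z
          (λ y⊇z → x≢y (inside-antisym x⊇y (proj₂ Y y⊇z)))
          (λ z⊇y → x≢z (inside-antisym x⊇z (proj₂ Z z⊇y))))
        x⊇y x⊇z
      where x⊇z = proj₁ X x⊇y

  no-unseparated-claw : ∀ {x y z} → Crosses c x → Crosses c y → Crosses c z →
    ¬ Crosses x y → ¬ Crosses x z → ¬ Crosses y z → x ≢ y → x ≢ z → y ≢ z →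
    SameSide x y z → SameSide y x z → ¬ SameSide z x y
  no-unseparated-claw {x} {y} {z} cx cy cz x∥y x∥z y∥z x≢y x≢z y≢z X Y Z
    with inside? x y | inside? y x | inside? z x
  ... | yes x⊇y | _ | _ = outer cx cy cz y∥z x≢y x≢z X Y Z x⊇y
  ... | _ | yes y⊇x | _ =
    outer cy cx cz x∥z (x≢y ∘ sym) y≢z Y X (sameSide-sym Z) y⊇x
  ... | _ | _ | yes z⊇x =
    outer cz cx cy x∥y (x≢z ∘ sym) (y≢z ∘ sym) Z (sameSide-sym X) (sameSide-sym Y) z⊇x
  ... | no x⊉y | no y⊉x | no z⊉x with crosses⇒∋ cx | crosses⇒∋ cy | crosses⇒∋ cz
  ...   | inj₁ p | inj₁ q | _      = unnested⇒apart x∥y x⊉y y⊉x p q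
  ...   | inj₂ p | inj₂ q | _      = unnested⇒apart x∥y x⊉y y⊉x p q
  ...   | inj₁ p | inj₂ _ | inj₁ r = unnested⇒apart x∥z (x⊉y ∘ proj₂ X) z⊉x p r
  ...   | inj₂ p | inj₁ _ | inj₂ r = unnested⇒apart x∥z (x⊉y ∘ proj₂ X) z⊉x p r
  ...   | inj₁ _ | inj₂ q | inj₂ r = unnested⇒apart y∥z (y⊉x ∘ proj₂ Y) (z⊉x ∘ proj₂ Z) q r
  ...   | inj₂ _ | inj₁ q | inj₁ r = unnested⇒apart y∥z (y⊉x ∘ proj₂ Y) (z⊉x ∘ proj₂ Z) q r

-- Subdivided walls

module _ {A : Set} where

  pathPt-suc : ∀ {a b : A} ℓ mid k →
    pathPt a b ℓ mid (suc k) ≡ b ⊎ ∃ λ i → pathPt a b ℓ mid (suc k) ≡ mid i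
  pathPt-suc zero    mid zero    = inj₁ refl
  pathPt-suc (suc ℓ) mid zero    = inj₂ (zero , refl)
  pathPt-suc (suc ℓ) mid (suc k) with pathPt-suc {mid zero} ℓ (mid ∘ suc) k
  ... | inj₁ eq       = inj₁ eq
  ... | inj₂ (i , eq) = inj₂ (suc i , eq)

  pathPt-inject₁ : ∀ {a b : A} ℓ mid k →
    pathPt a b ℓ mid (inject₁ k) ≡ a ⊎ ∃ λ i → pathPt a b ℓ mid (inject₁ k) ≡ mid i
  pathPt-inject₁ ℓ       mid zero          = inj₁ refl
  pathPt-inject₁ (suc ℓ) mid (suc zero)    = inj₂ (zero , refl)
  pathPt-inject₁ (suc ℓ) mid (suc (suc k)) with pathPt-inject₁ ℓ (mid ∘ suc) (suc k)
  ... | inj₁ eq       = inj₂ (zero , eq)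
  ... | inj₂ (i , eq) = inj₂ (suc i , eq)

  pathPt-last : ∀ {a b : A} ℓ mid → pathPt a b ℓ mid (fromℕ (suc ℓ)) ≡ b
  pathPt-last zero    mid = refl
  pathPt-last (suc ℓ) mid = pathPt-last ℓ (mid ∘ suc)

  chain : (_~_ : A → A → Set) → (∀ {x} → x ~ x) → (∀ {x y z} → x ~ y → y ~ z → x ~ z) →
          ∀ k (f : Fin (suc k) → A) → (∀ i → f (inject₁ i) ~ f (suc i)) → f zero ~ f (fromℕ k)
  chain _~_ r t zero    f s = r
  chain _~_ r t (suc k) f s = t (s zero) (chain _~_ r t k (f ∘ suc) (s ∘ suc))

module _ {H : PGraph} {key : PGraph.V H → ℕ} (ℓ : Edge H key → ℕ) where

  open PGraph H
  open Subdivision H key ℓ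

  private
    src tgt : Edge H key → V
    src e = proj₁ (proj₁ e)
    tgt e = proj₂ (proj₁ e)

  On : Edge H key → SV → Set
  On e v = (v ≡ inj₁ (src e) ⊎ v ≡ inj₁ (tgt e)) ⊎ ∃ λ i → v ≡ inj₂ (e , i)

  on-inject₁ : ∀ e k → On e (pt e (inject₁ k))
  on-inject₁ e k with pathPt-inject₁ (ℓ e) (λ i → inj₂ (e , i)) k
  ... | inj₁ eq = inj₁ (inj₁ eq)
  ... | inj₂ eq = inj₂ eq

  on-suc : ∀ e k → On e (pt e (suc k))
  on-suc e k with pathPt-suc (ℓ e) (λ i → inj₂ (e , i)) k
  ... | inj₁ eq = inj₁ (inj₂ eq)
  ... | inj₂ eq = inj₂ eq

  -- Meant for chords that must not meet: near `X` is `X` itself or the interior of an edge at `X`.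
  -- Being far excludes the neighbours of `X` too, as they are adjacent to near vertices.
  Near Far : V → SV → Set
  Near X (inj₁ w)       = w ≡ X
  Near X (inj₂ (e , _)) = src e ≡ X ⊎ tgt e ≡ X
  Far X (inj₁ w)       = w ≢ X × ¬ E X w × ¬ E w X
  Far X (inj₂ (e , _)) = src e ≢ X × tgt e ≢ X

  near-far⇒≢ : ∀ {X} x v → Near X x → Far X v → x ≢ v
  near-far⇒≢ (inj₁ _) _ w≡X (w≢X , _) refl = w≢X w≡X
  near-far⇒≢ (inj₂ _) _ (inj₁ s) (s≢ , _) refl = s≢ s
  near-far⇒≢ (inj₂ _) _ (inj₂ t) (_ , t≢) refl = t≢ t

  private
    near-end : ∀ {X e x} → On e x → Near X x → src e ≡ X ⊎ tgt e ≡ X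
    near-end (inj₁ (inj₁ refl)) nr = inj₁ nr
    near-end (inj₁ (inj₂ refl)) nr = inj₂ nr
    near-end (inj₂ (_ , refl))  nr = nr

    end-far : ∀ {X e v} → On e v → Far X v → ¬ (src e ≡ X ⊎ tgt e ≡ X)
    end-far             (inj₁ (inj₁ refl)) (w≢X , _)      (inj₁ s)    = w≢X s
    end-far {e = _ , p} (inj₁ (inj₁ refl)) (_ , _ , ¬wX)  (inj₂ refl) = ¬wX (proj₁ p)
    end-far {e = _ , p} (inj₁ (inj₂ refl)) (_ , ¬Xw , _)  (inj₁ refl) = ¬Xw (proj₁ p)
    end-far             (inj₁ (inj₂ refl)) (w≢X , _)      (inj₂ t)    = w≢X t
    end-far             (inj₂ (_ , refl))  (s≢ , _)       (inj₁ s)    = s≢ s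
    end-far             (inj₂ (_ , refl))  (_ , t≢)       (inj₂ t)    = t≢ t

  -- An edge of the subdivision lies on the path of a single `e`; its near end forces `X` to be an
  -- end of `e`, and its far end forbids this.
  near-far⇒¬SE : ∀ {X} x v → Near X x → Far X v → ¬ SE x v
  near-far⇒¬SE x v nr fr ((e , k) , inj₁ (refl , refl)) =
    end-far (on-suc e k) fr (near-end (on-inject₁ e k) nr)
  near-far⇒¬SE x v nr fr ((e , k) , inj₂ (refl , refl)) =
    end-far (on-inject₁ e k) fr (near-end (on-suc e k) nr)

  -- The neighbours of the source and of the target on the path of `e`; with `ℓ e` zero they are the
  -- opposite ends.
  firstPt lastPt : Edge H key → SV
  firstPt e = pt e (suc zero)
  lastPt  e = pt e (inject₁ (fromℕ (ℓ e)))

  pt-last : ∀ e → pt e (suc (fromℕ (ℓ e))) ≡ inj₁ (tgt e)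
  pt-last e = pathPt-last (ℓ e) (λ i → inj₂ (e , i))

  SE-firstPt : ∀ e → SE (inj₁ (src e)) (firstPt e)
  SE-firstPt e = (e , zero) , inj₁ (refl , refl)

  SE-lastPt : ∀ e → SE (inj₁ (tgt e)) (lastPt e)
  SE-lastPt e = (e , fromℕ (ℓ e)) , inj₂ (refl , pt-last e)

  far-suc : ∀ {X} e → Far X (inj₁ (tgt e)) → src e ≢ X → ∀ k → Far X (pt e (suc k))
  far-suc {X} e fr s≢ k
    with pathPt-suc {a = inj₁ (src e)} {inj₁ (tgt e)} (ℓ e) (λ i → inj₂ (e , i)) k
  ... | inj₁ eq       = subst (Far X) (sym eq) fr
  ... | inj₂ (i , eq) = subst (Far X) (sym eq) (s≢ , proj₁ fr)

  far-inject₁ : ∀ {X} e → Far X (inj₁ (src e)) → tgt e ≢ X → ∀ k → Far X (pt e (inject₁ k))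
  far-inject₁ {X} e fr t≢ k
    with pathPt-inject₁ {a = inj₁ (src e)} {inj₁ (tgt e)} (ℓ e) (λ i → inj₂ (e , i)) k
  ... | inj₁ eq       = subst (Far X) (sym eq) fr
  ... | inj₂ (i , eq) = subst (Far X) (sym eq) (proj₁ fr , t≢)

  near-firstPt : ∀ e → Near (tgt e) (firstPt e)
  near-firstPt e with pathPt-suc {a = inj₁ (src e)} {inj₁ (tgt e)} (ℓ e) (λ i → inj₂ (e , i)) zero
  ... | inj₁ eq       = subst (Near (tgt e)) (sym eq) refl
  ... | inj₂ (i , eq) = subst (Near (tgt e)) (sym eq) (inj₂ refl)

  near-lastPt : ∀ e → Near (src e) (lastPt e)
  near-lastPt e
    with pathPt-inject₁ {a = inj₁ (src e)} {inj₁ (tgt e)} (ℓ e) (λ i → inj₂ (e , i)) (fromℕ (ℓ e))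
  ... | inj₁ eq       = subst (Near (src e)) (sym eq) refl
  ... | inj₂ (i , eq) = subst (Near (src e)) (sym eq) (inj₁ refl)

  module Drawing (ψ : SV → Chord)
    (SE⇒crosses : ∀ {u v} → SE u v → Crosses (ψ u) (ψ v))
    (crosses⇒SE : ∀ {u v} → Crosses (ψ u) (ψ v) → SE u v) where

    near-far⇒¬crosses : ∀ {X} x v → Near X x → Far X v → ¬ Crosses (ψ x) (ψ v)
    near-far⇒¬crosses x v nr fr = near-far⇒¬SE x v nr fr ∘ crosses⇒SE

    module _ {X : V} (x : SV) (nr : Near X x) where

      infix 4 _~_
      _~_ : SV → SV → Set
      u ~ v = SameSide (ψ x) (ψ u) (ψ v)

      ~-trans : ∀ {u v w} → u ~ v → v ~ w → u ~ w
      ~-trans = sameSide-trans {ψ x}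

      -- Neither chord crosses `ψ x`, but they cross each other, so `ψ x` cannot separate them.
      ~-step : ∀ {u v} → Far X u → Far X v → SE u v → u ~ v
      ~-step fu fv uv = crosses⇒sameSide (near-far⇒¬crosses x _ nr fu)
                          (near-far⇒¬crosses x _ nr fv) (SE⇒crosses uv)

      -- The walk stops one vertex short of the target, which may thus be a neighbour of `X`: it is
      -- applied with the centre of the three bricks as target.
      src~lastPt : ∀ e → Far X (inj₁ (src e)) → tgt e ≢ X → inj₁ (src e) ~ lastPt e
      src~lastPt e fs t≢ = chain _~_ (id , id) ~-trans (ℓ e) (pt e ∘ inject₁) λ i →
        ~-step (far-inject₁ e fs t≢ (inject₁ i)) (far-inject₁ e fs t≢ (suc i))
               ((e , inject₁ i) , inj₁ (refl , refl))

      firstPt~tgt : ∀ e → Far X (inj₁ (tgt e)) → src e ≢ X → firstPt e ~ inj₁ (tgt e)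
      firstPt~tgt e ft s≢ = subst (firstPt e ~_) (pt-last e)
        (chain _~_ (id , id) ~-trans (ℓ e) (pt e ∘ suc) λ i →
        ~-step (far-suc e ft s≢ (inject₁ i)) (far-suc e ft s≢ (suc i))
               ((e , suc i) , inj₁ (refl , refl)))

      src~tgt : ∀ e → Far X (inj₁ (src e)) → Far X (inj₁ (tgt e)) → inj₁ (src e) ~ inj₁ (tgt e)
      src~tgt e fs ft = ~-trans
        (~-step fs (far-suc e ft (proj₁ fs) zero) (SE-firstPt e))
        (firstPt~tgt e ft (proj₁ fs))

-- The vertex c = (1,2) of the wall lies on three bricks; x, y, z are its neighbours in the
-- subdivision, and each brick minus c joins two of them away from the third.
module ThreeBricks (ℓ : Edge (Wall 3) (wallKey 3) → ℕ) where

  open Subdivision (Wall 3) (wallKey 3) ℓ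

  private
    V = PGraph.V (Wall 3)

    at : ∀ i j {kept : True (wallKept 3 (i , j) ≟ᵇ true)} → V
    at i j {kept} = (i , j) , toWitness kept

    link : ∀ u v {e : True (gridAdj 3 (proj₁ u) (proj₁ v) ≟ᵇ true)}
           {k : True (wallKey 3 u <? wallKey 3 v)} → Edge (Wall 3) (wallKey 3)
    link u v {e} {k} = (u , v) , toWitness e , toWitness k

    differ : ∀ {v w : V} {d : False (≡-dec _≟_ _≟_ (proj₁ v) (proj₁ w))} → v ≢ w
    differ {d = d} refl = toWitnessFalse d refl

    far : ∀ {X w} {d : False (≡-dec _≟_ _≟_ (proj₁ w) (proj₁ X))}
          {e : False (gridAdj 3 (proj₁ X) (proj₁ w) ≟ᵇ true)}
          {f : False (gridAdj 3 (proj₁ w) (proj₁ X) ≟ᵇ true)} → Far ℓ X (inj₁ w)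
    far {X} {w} {d} {e} {f} = differ {w} {X} {d} , toWitnessFalse e , toWitnessFalse f

    c X Y Z : V
    c = at (# 1) (# 2)
    X = at (# 0) (# 2)
    Y = at (# 1) (# 1)
    Z = at (# 1) (# 3)

    Xc Yc cZ : Edge (Wall 3) (wallKey 3)
    Xc = link X c
    Yc = link Y c
    cZ = link c Z

    x y z : SV
    x = lastPt ℓ Xc
    y = lastPt ℓ Yc
    z = firstPt ℓ cZ

    X≈x : Near ℓ X x
    X≈x = near-lastPt ℓ Xc
    Y≈y : Near ℓ Y y
    Y≈y = near-lastPt ℓ Yc
    Z≈z : Near ℓ Z z
    Z≈z = near-firstPt ℓ cZ

    X#y : Far ℓ X y
    X#y = far-inject₁ ℓ Yc (far {X} {Y}) (differ {c} {X}) (fromℕ (ℓ Yc))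
    X#z : Far ℓ X z
    X#z = far-suc ℓ cZ (far {X} {Z}) (differ {c} {X}) zero
    Y#z : Far ℓ Y z
    Y#z = far-suc ℓ cZ (far {Y} {Z}) (differ {c} {Y}) zero

  wall-subdivision-not-circle : (ψ : SV → Chord) → Injective _≡_ _≡_ ψ →
    (∀ {u v} → SE u v → Crosses (ψ u) (ψ v)) → ¬ (∀ {u v} → Crosses (ψ u) (ψ v) → SE u v)
  wall-subdivision-not-circle ψ inj SE⇒crosses crosses⇒SE =
    no-unseparated-claw {ψ (inj₁ c)} {ψ x} {ψ y} {ψ z}
      (SE⇒crosses (SE-lastPt ℓ Xc)) (SE⇒crosses (SE-lastPt ℓ Yc)) (SE⇒crosses (SE-firstPt ℓ cZ))
      (near-far⇒¬crosses x y X≈x X#y) (near-far⇒¬crosses x z X≈x X#z)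
      (near-far⇒¬crosses y z Y≈y Y#z)
      (near-far⇒≢ ℓ x y X≈x X#y ∘ inj) (near-far⇒≢ ℓ x z X≈x X#z ∘ inj)
      (near-far⇒≢ ℓ y z Y≈y Y#z ∘ inj)
      around-x around-y around-z
    where
    open Drawing ℓ ψ SE⇒crosses crosses⇒SE

    along : ∀ {U u} → Near ℓ U u → ∀ e → Far ℓ U (inj₁ (proj₁ (proj₁ e))) →
            Far ℓ U (inj₁ (proj₂ (proj₁ e))) →
            SameSide (ψ u) (ψ (inj₁ (proj₁ (proj₁ e)))) (ψ (inj₁ (proj₂ (proj₁ e))))
    along {u = u} U≈u = src~tgt u U≈u

    infixr 4 _⨾_
    _⨾_ : ∀ {a b d e} → SameSide a b d → SameSide a d e → SameSide a b e
    _⨾_ {a} = sameSide-trans {a}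

    back : ∀ {a b d} → SameSide a b d → SameSide a d b
    back {a} = sameSide-sym {a}

    -- `around-x` follows the brick below `c`, `around-y` the one above to the right, and `around-z`
    -- the one above to the left.
    around-x : SameSide (ψ x) (ψ y) (ψ z)
    around-x =
      back (src~lastPt x X≈x Yc far differ) ⨾
      along X≈x (link Y p₂₁) far far ⨾
      along X≈x (link p₂₁ p₂₂) far far ⨾
      along X≈x (link p₂₂ p₂₃) far far ⨾
      back (along X≈x (link Z p₂₃) far far) ⨾
      back (firstPt~tgt x X≈x cZ far differ)
      where
      p₂₁ = at (# 2) (# 1)
      p₂₂ = at (# 2) (# 2)
      p₂₃ = at (# 2) (# 3)

    around-y : SameSide (ψ y) (ψ x) (ψ z)
    around-y =
      back (src~lastPt y Y≈y Xc far differ) ⨾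
      along Y≈y (link X p₀₃) far far ⨾
      along Y≈y (link p₀₃ p₀₄) far far ⨾
      along Y≈y (link p₀₄ p₁₄) far far ⨾
      back (along Y≈y (link Z p₁₄) far far) ⨾
      back (firstPt~tgt y Y≈y cZ far differ)
      where
      p₀₃ = at (# 0) (# 3)
      p₀₄ = at (# 0) (# 4)
      p₁₄ = at (# 1) (# 4)

    around-z : SameSide (ψ z) (ψ x) (ψ y)
    around-z =
      back (src~lastPt z Z≈z Xc far differ) ⨾
      back (along Z≈z (link p₀₁ X) far far) ⨾
      back (along Z≈z (link p₀₀ p₀₁) far far) ⨾
      along Z≈z (link p₀₀ p₁₀) far far ⨾
      along Z≈z (link p₁₀ Y) far far ⨾
      src~lastPt z Z≈z Yc far differ
      where
      p₀₀ = at (# 0) (# 0)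
      p₀₁ = at (# 0) (# 1)
      p₁₀ = at (# 1) (# 0)

  -- The three edges of the subdivision at `c` pairwise share `c`.
  line-graph-triangle : ∃ λ f → ∃ λ g → ∃ λ h →
    PGraph.E lineGraph f g × PGraph.E lineGraph f h × PGraph.E lineGraph g h
  line-graph-triangle =
    (Xc , fromℕ _) , (Yc , fromℕ _) , (cZ , zero) ,
    ((λ ()) , suc zero , suc zero , trans (pt-last ℓ Xc) (sym (pt-last ℓ Yc))) ,
    ((λ ()) , suc zero , zero , pt-last ℓ Xc) ,
    ((λ ()) , suc zero , zero , pt-last ℓ Yc)

-- Circle graphs with large complete minors

-- Old positions p move to 2 + 4p, and a new chord from 4a to 5 + 4a is put around each position a.
-- Consecutive new chords overlap, and the new chord a meets an old one only if that ends at a.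
positions : ℕ → ℕ
positions zero    = 1
positions (suc k) = 2 + positions k * 4

Vertex : ℕ → Set
Vertex zero    = ⊥
Vertex (suc k) = Vertex k ⊎ Fin (positions k)

lo hi : ∀ k → Vertex k → ℕ
lo (suc k) (inj₁ v) = 2 + lo k v * 4
lo (suc k) (inj₂ a) = toℕ a * 4
hi (suc k) (inj₁ v) = 2 + hi k v * 4
hi (suc k) (inj₂ a) = 5 + toℕ a * 4

chord : ∀ k → Vertex k → Chord
chord k v = lo k v , hi k v

crosses⇒≢ : ∀ k u v → Crosses (chord k u) (chord k v) → u ≢ v
crosses⇒≢ k u u c refl = crosses-irrefl c

-- With P = `positions k`, the last new chord ends at 5 + 4(P - 1) = 4P + 1, just below the next
-- number of positions.
hi<positions : ∀ k v → hi k v < positions k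
hi<positions (suc k) (inj₁ v) = +-monoʳ-< 2 (*-monoˡ-< 4 (hi<positions k v))
hi<positions (suc k) (inj₂ a) = s≤s (s≤s (*-monoˡ-≤ 4 (toℕ<n a)))

-- If the ends of a chord were consecutive, the new chords around them would form a triangle with
-- it.
1+lo<hi : ∀ k v → suc (lo k v) < hi k v
1+lo<hi (suc k) (inj₁ v) =
  ≤-trans (+-monoʳ-≤ 4 (m≤n+m (lo k v * 4) 6)) (+-monoʳ-≤ 2 (*-monoˡ-≤ 4 (1+lo<hi k v)))
1+lo<hi (suc k) (inj₂ a) = +-monoˡ-< (toℕ a * 4) (s≤s (s≤s z≤n))

lo<hi : ∀ k v → lo k v < hi k v
lo<hi k v = <-trans (n<1+n _) (1+lo<hi k v)

EndsAt : ∀ k → Vertex k → ℕ → Set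
EndsAt k v p = lo k v ≡ p ⊎ hi k v ≡ p

residue : ∀ c d {p q} → c + p * 4 ≡ d + q * 4 → c % 4 ≡ d % 4
residue c d {p} {q} eq =
  trans (sym ([m+kn]%n≡m%n c p 4)) (trans (cong (_% 4) eq) ([m+kn]%n≡m%n d q 4))

quotient : ∀ c {p q} → c + p * 4 ≡ c + q * 4 → p ≡ q
quotient c {p} {q} eq = *-cancelʳ-≡ p q 4 (+-cancelˡ-≡ c _ _ eq)

private
  refined-end : ∀ k v {p} → EndsAt (suc k) (inj₁ v) p → ∃ λ q → EndsAt k v q × 2 + q * 4 ≡ p
  refined-end k v (inj₁ eq) = lo k v , inj₁ refl , eq
  refined-end k v (inj₂ eq) = hi k v , inj₂ refl , eq

  fresh≢refined : ∀ k a q → ¬ EndsAt (suc k) (inj₂ a) (2 + q * 4)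
  fresh≢refined k a q (inj₁ eq) with () ← residue 0 2 {toℕ a} {q} eq
  fresh≢refined k a q (inj₂ eq) with () ← residue 5 2 {toℕ a} {q} eq

-- The residue modulo 4 reveals the kind of an end: 2 for old chords, 0 for left and 1 for right
-- ends of new ones. Within a kind the quotient decides.
end-unique : ∀ k u v {p} → EndsAt k u p → EndsAt k v p → u ≡ v
end-unique (suc k) (inj₁ u) (inj₁ v) up vp with refined-end k u up | refined-end k v vp
... | q , uq , refl | r , vr , eq =
  cong inj₁ (end-unique k u v uq (subst (EndsAt k v) (quotient 2 eq) vr))
end-unique (suc k) (inj₁ u) (inj₂ b) up bp with refined-end k u up
... | q , _ , refl = contradiction bp (fresh≢refined k b q)
end-unique (suc k) (inj₂ a) (inj₁ v) ap vp with refined-end k v vp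
... | q , _ , refl = contradiction ap (fresh≢refined k a q)
end-unique (suc k) (inj₂ a) (inj₂ b) (inj₁ p) (inj₁ q) =
  cong inj₂ (toℕ-injective (quotient 0 (trans p (sym q))))
end-unique (suc k) (inj₂ a) (inj₂ b) (inj₂ p) (inj₂ q) =
  cong inj₂ (toℕ-injective (quotient 5 (trans p (sym q))))
end-unique (suc k) (inj₂ a) (inj₂ b) (inj₁ p) (inj₂ q)
  with () ← residue 0 5 {toℕ a} {toℕ b} (trans p (sym q))
end-unique (suc k) (inj₂ a) (inj₂ b) (inj₂ p) (inj₁ q)
  with () ← residue 5 0 {toℕ a} {toℕ b} (trans p (sym q))

chord-injective : ∀ k → Injective _≡_ _≡_ (chord k)
chord-injective k {u} {v} eq = end-unique k u v (inj₁ (cong proj₁ eq)) (inj₁ refl)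

private
  refine-< : ∀ {p q} → p < q → 2 + p * 4 < 2 + q * 4
  refine-< = +-monoʳ-< 2 ∘ *-monoˡ-< 4

  refine-<⁻¹ : ∀ {p q} → 2 + p * 4 < 2 + q * 4 → p < q
  refine-<⁻¹ {p} {q} = *-cancelʳ-< 4 p q ∘ +-cancelˡ-< 2 _ _

  -- Strictly between 4a and 5 + 4a lie one refined position, 2 + 4a, and one left end of a new
  -- chord, 4(a + 1); the latter gives `next-cell`.
  cell : ∀ {a p} → a * 4 < 2 + p * 4 → 2 + p * 4 < 5 + a * 4 → p ≡ a
  cell {a} {p} l r = ≤-antisym
    (s≤s⁻¹ (*-cancelʳ-< 4 p (suc a) (<-trans (+-cancelˡ-< 2 _ _ r) (n<1+n _))))
    (s≤s⁻¹ (*-cancelʳ-< 4 a (suc p) (<-≤-trans l (m≤n+m (2 + p * 4) 2))))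

  next-cell : ∀ {a b} → a * 4 < b * 4 → b * 4 < 5 + a * 4 → suc a ≡ b
  next-cell {a} {b} l r = ≤-antisym (*-cancelʳ-< 4 a b l)
    (s≤s⁻¹ (*-cancelʳ-< 4 b (2 + a) (<-≤-trans r (m≤n+m (5 + a * 4) 3))))

old-crosses : ∀ k {u v} → Crosses (chord k u) (chord k v) →
              Crosses (chord (suc k) (inj₁ u)) (chord (suc k) (inj₁ v))
old-crosses k (inj₁ (p , q , r)) = inj₁ (refine-< p , refine-< q , refine-< r)
old-crosses k (inj₂ (p , q , r)) = inj₂ (refine-< p , refine-< q , refine-< r)

old-crosses⁻¹ : ∀ k {u v} → Crosses (chord (suc k) (inj₁ u)) (chord (suc k) (inj₁ v)) →
                Crosses (chord k u) (chord k v)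
old-crosses⁻¹ k (inj₁ (p , q , r)) = inj₁ (refine-<⁻¹ p , refine-<⁻¹ q , refine-<⁻¹ r)
old-crosses⁻¹ k (inj₂ (p , q , r)) = inj₂ (refine-<⁻¹ p , refine-<⁻¹ q , refine-<⁻¹ r)

-- The right end of `v` is at least one position later, so it moves to 6 + 4 `lo k v` or beyond,
-- past the new chord.
old-crosses-new : ∀ k v {a} → lo k v ≡ toℕ a →
                  Crosses (chord (suc k) (inj₁ v)) (chord (suc k) (inj₂ a))
old-crosses-new k v {a} eq rewrite sym eq = inj₂
  ( m<n+m _ z<s , +-monoˡ-< (lo k v * 4) (s≤s (s≤s (s≤s z≤n)))
  , +-monoʳ-≤ 2 (*-monoˡ-≤ 4 (lo<hi k v)) )

old-crosses-new⁻¹ : ∀ k v {a} → Crosses (chord (suc k) (inj₁ v)) (chord (suc k) (inj₂ a)) →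
                    EndsAt k v (toℕ a)
old-crosses-new⁻¹ k v (inj₁ (_ , q , r)) = inj₂ (cell q r)
old-crosses-new⁻¹ k v (inj₂ (p , q , _)) = inj₁ (cell p q)

new-crosses-new : ∀ k {a b} → toℕ b ≡ suc (toℕ a) →
                  Crosses (chord (suc k) (inj₂ a)) (chord (suc k) (inj₂ b))
new-crosses-new k {a} {b} eq rewrite eq = inj₁
  (m<n+m _ z<s , n<1+n _ , +-monoˡ-< (toℕ a * 4) (m≤m+n 6 3))

new-crosses-new⁻¹ : ∀ k {a b} → Crosses (chord (suc k) (inj₂ a)) (chord (suc k) (inj₂ b)) →
                    suc (toℕ a) ≡ toℕ b ⊎ suc (toℕ b) ≡ toℕ a
new-crosses-new⁻¹ k (inj₁ (p , q , _)) = inj₁ (next-cell p q)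
new-crosses-new⁻¹ k (inj₂ (p , q , _)) = inj₂ (next-cell p q)

-- Construction order, degeneracy and excluded subgraphs

size : ℕ → ℕ
size zero    = 0
size (suc k) = size k + positions k

enumeration : ∀ k → Fin (size k) ↔ Vertex k
enumeration zero    = 0↔⊥
enumeration (suc k) = ↔-trans +↔⊎ (enumeration k ⊎-↔ ↔-id _)

-- The order of construction: older generations first, each generation from left to right.
rank : ∀ k → Vertex k → ℕ
rank (suc k) (inj₁ v) = rank k v
rank (suc k) (inj₂ a) = size k + toℕ a

rank<size : ∀ k v → rank k v < size k
rank<size (suc k) (inj₁ v) = <-≤-trans (rank<size k v) (m≤m+n _ _)
rank<size (suc k) (inj₂ a) = +-monoʳ-< (size k) (toℕ<n a)

private
  old<new : ∀ k v (a : Fin (positions k)) → rank (suc k) (inj₁ v) < rank (suc k) (inj₂ a)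
  old<new k v a = <-≤-trans (rank<size k v) (m≤m+n _ _)

rank-injective : ∀ k → Injective _≡_ _≡_ (rank k)
rank-injective (suc k) {inj₁ u} {inj₁ v} eq = cong inj₁ (rank-injective k eq)
rank-injective (suc k) {inj₁ u} {inj₂ b} eq = contradiction (old<new k u b) (<-irrefl eq)
rank-injective (suc k) {inj₂ a} {inj₁ v} eq = contradiction (old<new k v a) (<-irrefl (sym eq))
rank-injective (suc k) {inj₂ a} {inj₂ b} eq =
  cong inj₂ (toℕ-injective (+-cancelˡ-≡ (size k) _ _ eq))

Before : ∀ k → Vertex k → Vertex k → Set
Before k u v = rank k u < rank k v × Crosses (chord k u) (chord k v)

-- Two kinds of earlier neighbours of the new chord `a`, with at most one chord of each: the old
-- chord ending at `a`, and the predecessor on the new path.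
data Earlier {k} (a : Fin (positions k)) : Vertex (suc k) → Set where
  old : ∀ {w} → EndsAt k w (toℕ a) → Earlier a (inj₁ w)
  new : ∀ {b} → suc (toℕ b) ≡ toℕ a → Earlier a (inj₂ b)

earlier : ∀ k u {a} → Before (suc k) u (inj₂ a) → Earlier a u
earlier k (inj₁ w) (_ , c) = old (old-crosses-new⁻¹ k w c)
earlier k (inj₂ b) {a} (b<a , c) with new-crosses-new⁻¹ k c
... | inj₁ eq = new eq
... | inj₂ eq = contradiction (+-cancelˡ-< (size k) _ _ b<a)
                  (<-asym (subst (toℕ a <_) eq (n<1+n _)))

before-old : ∀ k u {v} → Before (suc k) u (inj₁ v) → ∃ λ w → u ≡ inj₁ w × Before k w v
before-old k (inj₁ w) (w<v , c) = w , refl , w<v , old-crosses⁻¹ k c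
before-old k (inj₂ b) {v} (b<v , _) = contradiction b<v (<-asym (old<new k v b))

private
  same-old : ∀ {k u v} {a : Fin (positions k)} → EndsAt k u (toℕ a) → EndsAt k v (toℕ a) →
             _≡_ {A = Vertex (suc k)} (inj₁ u) (inj₁ v)
  same-old p q = cong inj₁ (end-unique _ _ _ p q)

  same-new : ∀ {k} {a b c : Fin (positions k)} → suc (toℕ b) ≡ toℕ a → suc (toℕ c) ≡ toℕ a →
             _≡_ {A = Vertex (suc k)} (inj₂ b) (inj₂ c)
  same-new p q = cong inj₂ (toℕ-injective (ℕ-suc-injective (trans p (sym q))))

-- Among three earlier neighbours of a new chord, two have the same kind in `Earlier` and coincide.
-- Before an old chord there are only old chords, so induction applies.
2-degenerate : ∀ k v x y z → x ≢ y → x ≢ z → y ≢ z →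
               Before k x v → Before k y v → ¬ Before k z v
2-degenerate (suc k) (inj₁ v) x y z x≢y x≢z y≢z xv yv zv
  with before-old k x xv | before-old k y yv | before-old k z zv
... | x′ , refl , p | y′ , refl , q | z′ , refl , r =
  2-degenerate k v x′ y′ z′ (x≢y ∘ cong inj₁) (x≢z ∘ cong inj₁) (y≢z ∘ cong inj₁) p q r
2-degenerate (suc k) (inj₂ a) x y z x≢y x≢z y≢z xv yv zv
  with earlier k x xv | earlier k y yv | earlier k z zv
... | old p | old q | _     = x≢y (same-old p q)
... | new p | new q | _     = x≢y (same-new p q)
... | old p | new _ | old r = x≢z (same-old p r)
... | new p | old _ | new r = x≢z (same-new p r)
... | old _ | new q | new r = y≢z (same-new q r)
... | new _ | old q | old r = y≢z (same-old q r)

no-consecutive-ends : ∀ k v {p} → EndsAt k v p → ¬ EndsAt k v (suc p)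
no-consecutive-ends k v (inj₁ refl) (inj₁ eq) = 1+n≢n (sym eq)
no-consecutive-ends k v (inj₁ refl) (inj₂ eq) = <-irrefl (sym eq) (1+lo<hi k v)
no-consecutive-ends k v (inj₂ refl) (inj₁ eq) =
  <-asym (lo<hi k v) (subst (hi k v <_) (sym eq) (n<1+n _))
no-consecutive-ends k v (inj₂ refl) (inj₂ eq) = 1+n≢n (sym eq)

-- Earlier neighbours of different kinds are an old chord ending at `a` and the new chord around the
-- position before `a`. They would cross only if the old chord ended there too.
before-independent : ∀ k v x y → Before k x v → Before k y v → ¬ Crosses (chord k x) (chord k y)
before-independent (suc k) (inj₁ v) x y xv yv with before-old k x xv | before-old k y yv
... | x′ , refl , p | y′ , refl , q = before-independent k v x′ y′ p q ∘ old-crosses⁻¹ k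
before-independent (suc k) (inj₂ a) x y xv yv xy with earlier k x xv | earlier k y yv
... | old p | old q = crosses⇒≢ (suc k) x y xy (same-old p q)
... | new p | new q = crosses⇒≢ (suc k) x y xy (same-new p q)
... | old {w} p | new q =
  no-consecutive-ends k w (old-crosses-new⁻¹ k w xy) (subst (EndsAt k w) (sym q) p)
... | new p | old {w} q =
  no-consecutive-ends k w (old-crosses-new⁻¹ k w (crosses-sym xy)) (subst (EndsAt k w) (sym p) q)

private
  order : ∀ k u v → Crosses (chord k u) (chord k v) → Before k u v ⊎ Before k v u
  order k u v c with <-cmp (rank k u) (rank k v)
  ... | tri< u<v _ _ = inj₁ (u<v , c)
  ... | tri> _ _ v<u = inj₂ (v<u , crosses-sym c)
  ... | tri≈ _ eq _  = contradiction (rank-injective k eq) (crosses⇒≢ k u v c)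

-- The latest vertex of a triangle would have two adjacent earlier neighbours; the last two cases
-- are cyclic orders.
triangle-free : ∀ k x y z → Crosses (chord k x) (chord k y) → Crosses (chord k x) (chord k z) →
                ¬ Crosses (chord k y) (chord k z)
triangle-free k x y z xy xz yz with order k x y xy | order k x z xz | order k y z yz
... | inj₁ x<y | _        | inj₂ z<y = before-independent k y x z x<y z<y xz
... | _        | inj₁ x<z | inj₁ y<z = before-independent k z x y x<z y<z xy
... | inj₂ y<x | inj₂ z<x | _        = before-independent k x y z y<x z<x yz
... | inj₁ x<y | inj₂ z<x | inj₁ y<z =
  <-asym (proj₁ x<y) (<-trans (proj₁ y<z) (proj₁ z<x))
... | inj₂ y<x | inj₁ x<z | inj₂ z<y =
  <-asym (proj₁ y<x) (<-trans (proj₁ x<z) (proj₁ z<y))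

maximum : ∀ {m} (f : Fin (suc m) → ℕ) → ∃ λ i → ∀ j → f j ≤ f i
maximum {zero}  f = zero , λ { zero → ≤-refl }
maximum {suc m} f with maximum (f ∘ suc)
... | i , max with ≤-total (f zero) (f (suc i))
...   | inj₁ le = suc i , λ { zero → le ; (suc j) → max j }
...   | inj₂ ge = zero , λ { zero → ≤-refl ; (suc j) → ≤-trans (max j) ge }

private
  3-before : ∀ k (f : Fin 3 → Vertex k) → Injective _≡_ _≡_ f → ∀ v → ¬ (∀ i → Before k (f i) v)
  3-before k f inj v b =
    2-degenerate k v _ _ _ ((λ ()) ∘ inj {zero} {suc zero}) ((λ ()) ∘ inj {zero} {suc (suc zero)})
      ((λ ()) ∘ inj {suc zero} {suc (suc zero)}) (b zero) (b (suc zero)) (b (suc (suc zero)))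

-- The latest of the six vertices would have the three vertices of the opposite side as earlier
-- neighbours.
K₃,₃-free : ∀ k (f g : Fin 3 → Vertex k) → Injective _≡_ _≡_ f → Injective _≡_ _≡_ g →
            ¬ (∀ i j → Crosses (chord k (f i)) (chord k (g j)))
K₃,₃-free k f g f-inj g-inj c with maximum (rank k ∘ f) | maximum (rank k ∘ g)
... | i , maxᶠ | j , maxᵍ with order k (f i) (g j) (c i j)
...   | inj₁ (i<j , _) = 3-before k f f-inj (g j) λ i′ → ≤-<-trans (maxᶠ i′) i<j , c i′ j
...   | inj₂ (j<i , _) =
  3-before k g g-inj (f i) λ j′ → ≤-<-trans (maxᵍ j′) j<i , crosses-sym (c i j′)

-- Generations as branch sets of a complete minor

level : ∀ k → Vertex k → Fin k
level (suc k) (inj₁ v) = suc (level k v)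
level (suc k) (inj₂ a) = zero

Linked : ∀ k → Vertex k → Vertex k → Set
Linked k u v = level k u ≡ level k v × Crosses (chord k u) (chord k v)

walk : ∀ {A : Set} {R : A → A → Set} → (∀ {x y} → R x y → R y x) → ∀ {m} (f : Fin m → A) →
       (∀ a b → toℕ b ≡ suc (toℕ a) → R (f a) (f b)) → ∀ a b → Star R (f a) (f b)
walk s f r zero    zero    = ε
walk s f r (suc a) (suc b) = walk s (f ∘ suc) (λ a b → r (suc a) (suc b) ∘ cong suc) a b
walk s {m = suc (suc _)} f r zero (suc b) =
  r zero (suc zero) refl ◅ walk s (f ∘ suc) (λ a b → r (suc a) (suc b) ∘ cong suc) zero b
walk s {m = suc (suc _)} f r (suc a) zero =
  walk s (f ∘ suc) (λ a b → r (suc a) (suc b) ∘ cong suc) a zero ◅◅ (s (r zero (suc zero) refl) ◅ ε)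

level-connected : ∀ k u v → level k u ≡ level k v → Star (Linked k) u v
level-connected (suc k) (inj₁ u) (inj₁ v) eq =
  gmap inj₁ (λ (same , c) → cong suc same , old-crosses k c)
    (level-connected k u v (suc-injective eq))
level-connected (suc k) (inj₂ a) (inj₂ b) eq =
  walk (λ (same , c) → sym same , crosses-sym c) inj₂ (λ _ _ e → refl , new-crosses-new k e) a b

-- There is always a position to surround, even before the first chord.
level-inhabited : ∀ k i → ∃ λ v → level k v ≡ i
level-inhabited (suc k) zero    = inj₂ (fromℕ< (0<positions k)) , refl
  where
  0<positions : ∀ k → 0 < positions k
  0<positions zero    = z<s
  0<positions (suc k) = z<s
level-inhabited (suc k) (suc i) with level-inhabited k i
... | v , refl = inj₁ v , refl

-- The newest generation has a chord around the left end of any older chord; crossings among older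
-- chords survive refinement.
levels-touch : ∀ k i j → i ≢ j →
  ∃ λ u → ∃ λ v → level k u ≡ i × level k v ≡ j × Crosses (chord k u) (chord k v)
levels-touch (suc k) zero    zero    i≢j = contradiction refl i≢j
levels-touch (suc k) (suc i) zero    i≢j with level-inhabited k i
... | v , refl = inj₁ v , inj₂ (fromℕ< lo<) , refl , refl ,
                 old-crosses-new k v (sym (toℕ-fromℕ< lo<))
  where
  lo< : lo k v < positions k
  lo< = <-trans (lo<hi k v) (hi<positions k v)
levels-touch (suc k) zero    (suc j) i≢j with levels-touch (suc k) (suc j) zero (λ ())
... | u , v , p , q , c = v , u , q , p , crosses-sym c
levels-touch (suc k) (suc i) (suc j) i≢j with levels-touch k i j (i≢j ∘ cong suc)
... | u , v , refl , refl , c = inj₁ u , inj₁ v , refl , refl , old-crosses k c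

-- The graphs and the contradiction

does⇒holds : ∀ {A : Set} (a? : Dec A) → does a? ≡ true → A
does⇒holds (yes a) _ = a

graph : ℕ → FinGraph
graph k = record
  { n      = size k
  ; adj    = λ u v → does (crosses? (position u) (position v))
  ; sym    = λ u v → does-⇔ (mk⇔ crosses-sym crosses-sym)
                       (crosses? (position u) (position v)) (crosses? (position v) (position u))
  ; irrefl = λ u → dec-false (crosses? (position u) (position u)) crosses-irrefl
  }
  where
  position : Fin (size k) → Chord
  position u = chord k (Inverse.to (enumeration k) u)

module _ (k : ℕ) where

  open Inverse (enumeration k) using (to; from; strictlyInverseˡ; strictlyInverseʳ)

  to-injective : Injective _≡_ _≡_ to
  to-injective {u} {v} eq =
    trans (sym (strictlyInverseʳ u)) (trans (cong from eq) (strictlyInverseʳ v))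

  adj⇒crosses : ∀ u v → adj (graph k) u v ≡ true → Crosses (chord k (to u)) (chord k (to v))
  adj⇒crosses u v = does⇒holds (crosses? (chord k (to u)) (chord k (to v)))

  crosses⇒adj : ∀ u v → Crosses (chord k (to u)) (chord k (to v)) → adj (graph k) u v ≡ true
  crosses⇒adj u v = dec-true (crosses? (chord k (to u)) (chord k (to v)))

  graph-circle : IsCircleGraph (graph k)
  graph-circle = chord k ∘ to , lo<hi k ∘ to , to-injective ∘ chord-injective k ,
    λ u v → adj⇒crosses u v , crosses⇒adj u v

  from-crosses : ∀ {u v} → Crosses (chord k u) (chord k v) → adj (graph k) (from u) (from v) ≡ true
  from-crosses {u} {v} = crosses⇒adj (from u) (from v) ∘
    subst₂ (λ x y → Crosses (chord k x) (chord k y))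
           (sym (strictlyInverseˡ u)) (sym (strictlyInverseˡ v))

  graph-treewidth : ∀ {w} → HasTreeDecomp (graph k) w → k ≤ suc w
  graph-treewidth = complete-minor⇒m≤1+w (graph k) (level k ∘ to)
    (λ u v eq → subst₂ (Star _) (strictlyInverseʳ u) (strictlyInverseʳ v)
      (gmap from (λ (same , c) → trans (level-from _) (trans same (sym (level-from _))) ,
                               from-crosses c)
        (level-connected k (to u) (to v) eq)))
    (λ i j i≢j → let u , v , p , q , c = levels-touch k i j i≢j in
      from u , from v , trans (level-from u) p , trans (level-from v) q , from-crosses c)
    (λ i → let v , p = level-inhabited k i in from v , trans (level-from v) p)
    where
    level-from : ∀ v → level k (to (from v)) ≡ level k v
    level-from v = cong (level k) (strictlyInverseˡ v)

  module _ {H : PGraph} (copy : InducedIn H (graph k)) where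

    place : PGraph.V H → Vertex k
    place = to ∘ proj₁ copy

    place-injective : Injective _≡_ _≡_ place
    place-injective = proj₁ (proj₂ copy) ∘ to-injective

    E⇒crosses : ∀ {u v} → PGraph.E H u v → Crosses (chord k (place u)) (chord k (place v))
    E⇒crosses {u} {v} = adj⇒crosses _ _ ∘ proj₂ (proj₂ (proj₂ copy) u v)

    crosses⇒E : ∀ {u v} → Crosses (chord k (place u)) (chord k (place v)) → PGraph.E H u v
    crosses⇒E {u} {v} = proj₁ (proj₂ (proj₂ copy) u v) ∘ crosses⇒adj _ _

  -- Size 3 suffices: `K 3` and the line graphs contain triangles, and the wall of size 3 already
  -- has a vertex on three bricks.
  graph-unobstructed : ¬ Obstruction 3 (graph k)
  graph-unobstructed (inj₁ K₃) = triangle-free k _ _ _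
    (E⇒crosses K₃ {zero} {suc zero} λ ()) (E⇒crosses K₃ {zero} {suc (suc zero)} λ ())
    (E⇒crosses K₃ λ ())
  graph-unobstructed (inj₂ (inj₁ K₃,₃)) =
    K₃,₃-free k (place K₃,₃ ∘ inj₁) (place K₃,₃ ∘ inj₂)
      (inj₁-injective ∘ place-injective K₃,₃) (inj₂-injective ∘ place-injective K₃,₃)
      (λ i j → E⇒crosses K₃,₃ tt)
  graph-unobstructed (inj₂ (inj₂ (inj₁ (ℓ , wall)))) =
    ThreeBricks.wall-subdivision-not-circle ℓ (chord k ∘ place wall)
      (place-injective wall ∘ chord-injective k) (E⇒crosses wall) (crosses⇒E wall)
  graph-unobstructed (inj₂ (inj₂ (inj₂ (ℓ , line)))) =
    let _ , _ , _ , fg , fh , gh = ThreeBricks.line-graph-triangle ℓ in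
    triangle-free k _ _ _ (E⇒crosses line fg) (E⇒crosses line fh) (E⇒crosses line gh)

theorem21 : ¬ InducedTwBounded IsCircleGraph
theorem21 (f , obstruct) = graph-unobstructed k
  (obstruct (graph k) (graph-circle k) 3 λ w dec → s≤s⁻¹ (graph-treewidth k dec))
  where
  k : ℕ
  -- The minor gives only `k ≤ suc w`; the extra one turns this into `f 3 ≤ w`.
  k = suc (f 3)
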